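{- Let $T$ be a pr-tree and let $T'$ be a pr-tree obtained from $T$ by one transposition. Then $T$ and $T'$ have different parities: exactly one of $T$, $T'$ is even.
   Context: A pr-tree (plane rooted tree) is a finite tree embedded in the plane with a chosen root vertex and a chosen marked edge incident to the root; it is drawn growing downwards from the root with the marked edge leftmost. Equivalently, it is a rooted tree in which the children of every vertex are linearly ordered from left to right. The walk around a pr-tree starts at the root and traverses each edge twice, once in each direction, visiting the children of each vertex from left to right (depth-first, the tree always on the left of the walker), ending at the root. Bracket code: write an opening bracket when a vertex is met for the first time in the walk and a closing bracket when it is met for the last time. Thus, recursively, the code of a pr-tree whose root has pr-subtrees $T_1,\dots,T_s$ (left to right) is $(\,c(T_1)\cdots c(T_s)\,)$, and the one-vertex tree has code $()$. An inversion in a bracket code is a pair consisting of a closing bracket and an opening bracket, not necessarily adjacent, such that the closing bracket occurs before the opening bracket. A pr-tree is even if the number of inversions in its bracket code is even, and odd otherwise; this is its parity. Transposition: let $A,B,C$ be three vertices of a pr-tree such that $B$ has degree one and the walk meets vertices consecutively in the sequence $A,B,A,C$. The transposition moves the vertex $B$ with its attached edge along the single edge $AC$ from $A$ to $C$, on the side of the edge $AC$ along which the walk goes. Explicitly, $B$ is a childless child of $A$, and there are two cases: (i) if $C$ is the child of $A$ immediately following $B$ in the left-to-right order, then $B$ is removed from $A$ and becomes the first (leftmost) child of $C$; (ii) if $B$ is the last (rightmost) child of $A$ and $C$ is the parent of $A$, then $B$ is removed from $A$ and becomes a child of $C$ placed immediately after (to the right of) $A$. Everything else is unchanged. -}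

module Defs where

open import Data.Fin.Base using (Fin; _<_)
open import Data.Fin.Properties using (_<?_)
open import Data.List.Base using (List; []; _∷_; _++_; [_]; length; lookup; filter; allFin; cartesianProduct)
open import Data.Nat.Base using (ℕ)
open import Data.Nat.Divisibility using (_∣_)
open import Data.Product.Base using (_×_; _,_)
open import Relation.Binary.Definitions using (DecidableEquality)
open import Relation.Binary.PropositionalEquality using (_≡_; refl)
open import Relation.Nullary using (¬_; yes; no)
open import Relation.Nullary.Decidable using (_×-dec_)
open import Relation.Unary using (Pred; Decidable)

-- Plane rooted trees, as rooted trees whose children are listed from left to
-- right.  (Data.Tree.Rose uses sized types, which --safe rejects.)
data PRTree : Set where
  node : List PRTree → PRTree

leaf : PRTree
leaf = node []

data Bracket : Set where
  opening closing : Bracket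

_≟_ : DecidableEquality Bracket
opening ≟ opening = yes refl
opening ≟ closing = no λ ()
closing ≟ opening = no λ ()
closing ≟ closing = yes refl

mutual
  code : PRTree → List Bracket
  code (node ts) = opening ∷ codes ts ++ [ closing ]

  codes : List PRTree → List Bracket
  codes []       = []
  codes (t ∷ ts) = code t ++ codes ts

-- Inversions are pairs of positions in the code.
Inversion : (w : List Bracket) → Pred (Fin (length w) × Fin (length w)) _
Inversion w (i , j) = i < j × lookup w i ≡ closing × lookup w j ≡ opening

inversion? : (w : List Bracket) → Decidable (Inversion w)
inversion? w (i , j) = (i <? j) ×-dec (lookup w i ≟ closing) ×-dec (lookup w j ≟ opening)

#inversions : List Bracket → ℕ
#inversions w = length (filter (inversion? w) (cartesianProduct (allFin (length w)) (allFin (length w))))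

Even : PRTree → Set
Even T = 2 ∣ #inversions (code T)

Odd : PRTree → Set
Odd T = ¬ Even T

-- T ⟶ T′: the tree T′ is obtained from T by one transposition, in which the
-- walk meets A , B , A , C consecutively and the leaf B moves from A to C.
infix 4 _⟶_
data _⟶_ : PRTree → PRTree → Set where

  -- The displayed node is A, and C = node cs is its child next after B.
  down : ∀ ls cs rs →
    node (ls ++ leaf ∷ node cs ∷ rs) ⟶ node (ls ++ node (leaf ∷ cs) ∷ rs)

  -- The displayed node is C, and A is its child with last child B.
  up : ∀ ls as rs →
    node (ls ++ node (as ++ [ leaf ]) ∷ rs) ⟶ node (ls ++ node as ∷ leaf ∷ rs)

  -- The transposition takes place inside the subtree at a child of the root.
  inside : ∀ ls rs {t t′} → t ⟶ t′ →
    node (ls ++ t ∷ rs) ⟶ node (ls ++ t′ ∷ rs)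

{-# OPTIONS --safe #-}

-- A transposition replaces the factor )( of the code by () when it goes down the
-- tree, and () by )( when it goes up.  Exchanging two adjacent brackets changes
-- the relative order of no other pair, so the number of inversions changes by one.

module Submission where

open import Defs
open import Algebra.Properties.CommutativeSemigroup using (x∙yz≈y∙xz)
open import Data.Fin.Base using (Fin; zero; suc)
open import Data.List.Base using (List; []; _∷_; _++_; [_]; length; lookup; filter; map; allFin; cartesianProduct)
open import Data.List.Properties using (length-++; filter-++; map-∘; map-tabulate; tabulate-lookup; ++-assoc)
open import Data.List.Relation.Binary.Permutation.Propositional using (_↭_; refl; prep; swap)
open import Data.List.Relation.Binary.Permutation.Propositional.Properties using (↭-length; filter-↭)
open import Data.Nat.Base using (ℕ; zero; suc; _+_; s≤s; s≤s⁻¹; z<s)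
open import Data.Nat.Divisibility using (_∣_; _∣0; ∣1⇒≡1; ∣-refl; ∣m∣n⇒∣m+n; ∣m+n∣m⇒∣n)
open import Data.Nat.Properties using (+-suc; +-commutativeSemigroup)
open import Data.Product.Base as Product using (_×_; _,_; proj₂)
open import Data.Sum.Base as Sum using (_⊎_; inj₁; inj₂)
open import Function.Base using (_∘_; id)
open import Function.Bundles using (_⇔_; mk⇔; module Equivalence)
open import Level using (Level)
open import Relation.Binary.Construct.Closure.Symmetric using (SymClosure; fwd; bwd; gmap)
open import Relation.Binary.PropositionalEquality using (_≡_; refl; sym; trans; cong; cong₂; subst₂; module ≡-Reasoning)
open import Relation.Nullary using (¬_; yes; no; contradiction)
open import Relation.Nullary.Decidable using (_×-dec_)
open import Relation.Unary using (Pred; Decidable)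

private variable
  a b p q : Level
  A : Set a
  B : Set b

count : {P : Pred A p} → Decidable P → List A → ℕ
count P? xs = length (filter P? xs)

count-++ : {P : Pred A p} (P? : Decidable P) (xs ys : List A) →
  count P? (xs ++ ys) ≡ count P? xs + count P? ys
count-++ P? xs ys = trans (cong length (filter-++ P? xs ys)) (length-++ (filter P? xs))

count-map : {P : Pred A p} {Q : Pred B q} (P? : Decidable P) (Q? : Decidable Q) {f : A → B} →
  (∀ x → Q (f x) ⇔ P x) → ∀ xs → count Q? (map f xs) ≡ count P? xs
count-map P? Q? Qf⇔P []       = refl
count-map P? Q? {f} Qf⇔P (x ∷ xs) with Q? (f x) | P? x
... | yes _  | yes _  = cong suc (count-map P? Q? Qf⇔P xs)
... | no _   | no _   = count-map P? Q? Qf⇔P xs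
... | yes qx | no ¬px = contradiction (Equivalence.to (Qf⇔P x) qx) ¬px
... | no ¬qx | yes px = contradiction (Equivalence.from (Qf⇔P x) px) ¬qx

-- The order condition is left out, as `x` will stand in front of the word containing `y`. For `x`
-- equal to `opening` it never holds.
InvertedAfter : Bracket → Pred Bracket _
InvertedAfter x y = x ≡ closing × y ≡ opening

invertedAfter? : ∀ x → Decidable (InvertedAfter x)
invertedAfter? x y = (x ≟ closing) ×-dec (y ≟ opening)

count-inversions-zero : ∀ x w →
  count (inversion? (x ∷ w)) (map (zero ,_) (zero ∷ map suc (allFin (length w))))
    ≡ count (invertedAfter? x) w
count-inversions-zero x w = begin
  -- The pair `(zero , zero)` has dropped out by computation, since `zero < zero` fails.
  count (inversion? (x ∷ w)) (map (zero ,_) (map suc js))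
    ≡⟨ cong (count (inversion? (x ∷ w))) (map-∘ js) ⟨
  count (inversion? (x ∷ w)) (map (λ j → zero , suc j) js)
    ≡⟨ count-map after? (inversion? (x ∷ w)) (λ _ → mk⇔ proj₂ (z<s ,_)) js ⟩
  count after? js
    ≡⟨ count-map after? (invertedAfter? x) (λ _ → mk⇔ id id) js ⟨
  count (invertedAfter? x) (map (lookup w) js)
    ≡⟨ cong (count (invertedAfter? x)) (trans (map-tabulate id (lookup w)) (tabulate-lookup w)) ⟩
  count (invertedAfter? x) w ∎
  where
  open ≡-Reasoning
  js = allFin (length w)
  after? : Decidable (λ j → InvertedAfter x (lookup w j))
  after? j = invertedAfter? x (lookup w j)

-- Nothing is inverted with a second position `zero`, and shifting both positions by `suc` keeps
-- order and brackets. The lists are arbitrary so that the induction can shorten `is` while `js`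
-- stays fixed.
count-inversions-suc : ∀ x w (is js : List (Fin (length w))) →
  count (inversion? (x ∷ w)) (cartesianProduct (map suc is) (zero ∷ map suc js))
    ≡ count (inversion? w) (cartesianProduct is js)
count-inversions-suc x w []       js = refl
count-inversions-suc x w (i ∷ is) js = begin
  count xw? (map (suc i ,_) (map suc js) ++ rest)
    ≡⟨ count-++ xw? (map (suc i ,_) (map suc js)) rest ⟩
  count xw? (map (suc i ,_) (map suc js)) + count xw? rest
    ≡⟨ cong₂ _+_ row (count-inversions-suc x w is js) ⟩
  count w? (map (i ,_) js) + count w? (cartesianProduct is js)
    ≡⟨ count-++ w? (map (i ,_) js) (cartesianProduct is js) ⟨
  count w? (map (i ,_) js ++ cartesianProduct is js) ∎
  where
  open ≡-Reasoning
  xw? = inversion? (x ∷ w)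
  w? = inversion? w
  rest = cartesianProduct (map suc is) (zero ∷ map suc js)
  row : count xw? (map (suc i ,_) (map suc js)) ≡ count w? (map (i ,_) js)
  row = begin
    count xw? (map (suc i ,_) (map suc js))
      -- Both lists are `js` mapped by `λ j → suc i , suc j`.
      ≡⟨ cong (count xw?) (trans (sym (map-∘ js)) (map-∘ js)) ⟩
    count xw? (map (Product.map suc suc) (map (i ,_) js))
      ≡⟨ count-map w? xw? (λ _ → mk⇔ (Product.map₁ s≤s⁻¹) (Product.map₁ s≤s)) (map (i ,_) js) ⟩
    count w? (map (i ,_) js) ∎

-- Splitting off the first row of the square of positions gives a recursion on the word, which
-- replaces all further work with positions.
#inversions-∷ : ∀ x w → #inversions (x ∷ w) ≡ count (invertedAfter? x) w + #inversions w
#inversions-∷ x w = begin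
  #inversions (x ∷ w)
    ≡⟨ cong (λ is → count xw? (cartesianProduct (zero ∷ is) (zero ∷ is))) (map-tabulate id suc) ⟨
  count xw? (map (zero ,_) ks ++ cartesianProduct (map suc js) ks)
    ≡⟨ count-++ xw? (map (zero ,_) ks) (cartesianProduct (map suc js) ks) ⟩
  count xw? (map (zero ,_) ks) + count xw? (cartesianProduct (map suc js) ks)
    ≡⟨ cong₂ _+_ (count-inversions-zero x w) (count-inversions-suc x w js js) ⟩
  count (invertedAfter? x) w + #inversions w ∎
  where
  open ≡-Reasoning
  xw? = inversion? (x ∷ w)
  js = allFin (length w)
  ks = zero ∷ map suc js

infix 4 _⇝_
-- Directed from `)(` to `()`, so that each step loses an inversion.
data _⇝_ : List Bracket → List Bracket → Set where
  here  : ∀ w → closing ∷ opening ∷ w ⇝ opening ∷ closing ∷ w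
  there : ∀ x {v w} → v ⇝ w → x ∷ v ⇝ x ∷ w

⇝⇒↭ : ∀ {v w} → v ⇝ w → v ↭ w
⇝⇒↭ (here w)      = swap closing opening refl
⇝⇒↭ (there x v⇝w) = prep x (⇝⇒↭ v⇝w)

-- Only the exchanged pair matters: a bracket in front sees the same later brackets up to
-- permutation, and both exchanged brackets see the same `w` behind them.
#inversions-⇝ : ∀ {v w} → v ⇝ w → #inversions v ≡ suc (#inversions w)
#inversions-⇝ (here w) = begin
  #inversions (closing ∷ opening ∷ w)
    ≡⟨ #inversions-∷ closing (opening ∷ w) ⟩
  -- The `suc` is the exchanged pair itself, counted by computation.
  suc (c + #inversions (opening ∷ w))
    ≡⟨ cong (λ n → suc (c + n)) (#inversions-∷ opening w) ⟩
  suc (c + (o + #inversions w))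
    ≡⟨ cong suc (x∙yz≈y∙xz +-commutativeSemigroup c o (#inversions w)) ⟩
  suc (o + (c + #inversions w))
    ≡⟨ cong (λ n → suc (o + n)) (#inversions-∷ closing w) ⟨
  suc (o + #inversions (closing ∷ w))
    ≡⟨ cong suc (#inversions-∷ opening (closing ∷ w)) ⟨
  suc (#inversions (opening ∷ closing ∷ w)) ∎
  where
  open ≡-Reasoning
  c = count (invertedAfter? closing) w
  o = count (invertedAfter? opening) w
#inversions-⇝ (there x {v} {w} v⇝w) = begin
  #inversions (x ∷ v)
    ≡⟨ #inversions-∷ x v ⟩
  count (invertedAfter? x) v + #inversions v
    ≡⟨ cong₂ _+_ (↭-length (filter-↭ (invertedAfter? x) (⇝⇒↭ v⇝w))) (#inversions-⇝ v⇝w) ⟩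
  count (invertedAfter? x) w + suc (#inversions w)
    ≡⟨ +-suc _ (#inversions w) ⟩
  suc (count (invertedAfter? x) w + #inversions w)
    ≡⟨ cong suc (#inversions-∷ x w) ⟨
  suc (#inversions (x ∷ w)) ∎
  where open ≡-Reasoning

⇝-++ˡ : ∀ u {v w} → v ⇝ w → u ++ v ⇝ u ++ w
⇝-++ˡ []      v⇝w = v⇝w
⇝-++ˡ (x ∷ u) v⇝w = there x (⇝-++ˡ u v⇝w)

⇝-++ʳ : ∀ u {v w} → v ⇝ w → v ++ u ⇝ w ++ u
⇝-++ʳ u (here w)      = here (w ++ u)
⇝-++ʳ u (there x v⇝w) = there x (⇝-++ʳ u v⇝w)

codes-++ : ∀ ts us → codes (ts ++ us) ≡ codes ts ++ codes us
codes-++ []       us = refl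
codes-++ (t ∷ ts) us = trans (cong (code t ++_) (codes-++ ts us)) (sym (++-assoc (code t) (codes ts) (codes us)))

⇝-node : ∀ ls {ts us} → codes ts ⇝ codes us → code (node (ls ++ ts)) ⇝ code (node (ls ++ us))
⇝-node ls {ts} {us} ts⇝us rewrite codes-++ ls ts | codes-++ ls us =
  there opening (⇝-++ʳ [ closing ] (⇝-++ˡ (codes ls) ts⇝us))

-- Brings to light the factor `())`: the last leaf and the closing bracket of its parent.
code-node-∷ʳ-leaf : ∀ ts w →
  code (node (ts ++ [ leaf ])) ++ w ≡ (opening ∷ codes ts) ++ opening ∷ closing ∷ closing ∷ w
code-node-∷ʳ-leaf ts w rewrite codes-++ ts [ leaf ] =
  trans (++-assoc (opening ∷ codes ts ++ codes [ leaf ]) [ closing ] w)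
        (++-assoc (opening ∷ codes ts) (codes [ leaf ]) (closing ∷ w))

⟶⇒⇝ : ∀ {T T′} → T ⟶ T′ → SymClosure _⇝_ (code T) (code T′)
-- Here `()(` becomes `(()`; the first bracket is common to both.
⟶⇒⇝ (down ls cs rs) = fwd (⇝-node ls (there opening (here _)))
-- Here `())` becomes `)()`, so the exchange is read from the new tree to the old one.
⟶⇒⇝ (up ls as rs) = bwd (⇝-node ls (subst₂ _⇝_
  (sym (++-assoc (opening ∷ codes as) [ closing ] (opening ∷ closing ∷ codes rs)))
  (sym (code-node-∷ʳ-leaf as (codes rs)))
  (⇝-++ˡ (opening ∷ codes as) (here (closing ∷ codes rs)))))
⟶⇒⇝ (inside ls rs t⟶t′) = go (⟶⇒⇝ t⟶t′)
  where
  go : ∀ {t t′} → SymClosure _⇝_ (code t) (code t′) →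
    SymClosure _⇝_ (code (node (ls ++ t ∷ rs))) (code (node (ls ++ t′ ∷ rs)))
  go (fwd r) = fwd (⇝-node ls (⇝-++ʳ (codes rs) r))
  go (bwd r) = bwd (⇝-node ls (⇝-++ʳ (codes rs) r))

-- The alternatives trade places at each successor, because `2` divides `n` exactly when it divides
-- `suc (suc n)`.
even-xor-even-suc : ∀ n → (2 ∣ n × ¬ 2 ∣ suc n) ⊎ (¬ 2 ∣ n × 2 ∣ suc n)
even-xor-even-suc zero = inj₁ (2 ∣0 , λ 2∣1 → contradiction (∣1⇒≡1 2∣1) λ ())
even-xor-even-suc (suc n) with even-xor-even-suc n
... | inj₁ (2∣n , 2∤1+n) = inj₂ (2∤1+n , ∣m∣n⇒∣m+n ∣-refl 2∣n)
... | inj₂ (2∤n , 2∣1+n) = inj₁ (2∣1+n , λ 2∣2+n → 2∤n (∣m+n∣m⇒∣n 2∣2+n ∣-refl))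

proposition3p1 : (T T′ : PRTree) → T ⟶ T′ → (Even T × Odd T′) ⊎ (Odd T × Even T′)
proposition3p1 T T′ T⟶T′ with ⟶⇒⇝ T⟶T′
-- Now `T` has the larger number of inversions, so the dichotomy is taken at `T′` and its sides are
-- swapped.
... | fwd r rewrite #inversions-⇝ r =
  Sum.swap (Sum.map Product.swap Product.swap (even-xor-even-suc (#inversions (code T′))))
... | bwd r rewrite #inversions-⇝ r = even-xor-even-suc (#inversions (code T))
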